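{- Let $n=n_1n_2$ where $n_1$ and $n_2$ are coprime positive integers such that $\Omega^*(n_1)\ge 2$ and $\Omega^*(n_2)\ge 2$. Then the cyclic group of order $n$ is not a Schur group.
   Context: For a positive integer $m$, $\Omega(m)$ denotes the total number of prime factors of $m$ counted with multiplicity, and $\Omega^*(m)=\Omega(m)$ if $m$ is odd, $\Omega^*(m)=\Omega(m/2)$ if $m$ is even. An S-ring over a finite group $G$ is a subring $\mathcal A$ of $\mathbb Z G$ spanned by the sums $\underline X=\sum_{x\in X}x$ over the blocks $X$ of a partition of $G$ (basic sets) containing $\{e\}$ and closed under $X\mapsto X^{ -1}$. $\mathcal A$ is schurian if there is $\Gamma\le\mathrm{Sym}(G)$ containing all right translations such that the basic sets are the orbits of the stabilizer in $\Gamma$ of the identity; $G$ is a Schur group if every S-ring over $G$ is schurian. -}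

module Defs where

open import Level using (Level)
open import Data.Nat using (ℕ; zero; suc; _+_; _*_; _∸_; NonZero)
open import Data.Nat.DivMod using (_mod_)
open import Data.Nat.Divisibility using (_∣_)
open import Data.Nat.Primality using (Prime)
open import Data.Fin using (Fin; toℕ)
open import Data.Fin.Permutation using (Permutation′; _⟨$⟩ʳ_; id; flip; _∘ₚ_)
open import Data.List using (List; map; allFin)
open import Data.Nat.ListAction using (sum)
open import Data.Product using (Σ; _×_; _,_; ∃)
open import Relation.Binary.PropositionalEquality using (_≡_)
open import Relation.Nullary using (¬_; Dec; yes; no)
open import Function.Bundles using (_⇔_)
open import Data.Nat.Properties using (_≟_)
import Data.Fin as F

-- Ω(m): number of prime factors counted with multiplicity, as the
-- (functional, by unique factorisation) relation  HasΩ m k  ⟺  Ω(m) = k.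

data HasΩ : ℕ → ℕ → Set where
  Ω-one  : HasΩ 1 0
  Ω-step : ∀ {p m k} → Prime p → HasΩ m k → HasΩ (p * m) (suc k)

data HasΩ* : ℕ → ℕ → Set where
  Ω*-odd  : ∀ {m k} → ¬ (2 ∣ m) → HasΩ m k → HasΩ* m k
  Ω*-even : ∀ {m k} → HasΩ m k → HasΩ* (2 * m) k

module Cyclic (n : ℕ) .{{_ : NonZero n}} where

  G : Set
  G = Fin n

  e : G
  e = 0 mod n

  _⊕_ : G → G → G
  a ⊕ b = (toℕ a + toℕ b) mod n

  inv : G → G
  inv a = (n ∸ toℕ a) mod n

  -- A partition of G is given by a labelling  cls : G → ℕ ;
  -- the blocks (basic sets) are the fibres  {x | cls x ≡ cls y}.

  ⌊_⌋ : ∀ {P : Set} → Dec P → ℕ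
  ⌊ yes _ ⌋ = 1
  ⌊ no  _ ⌋ = 0

  _≟G_ : (a b : G) → Dec (a ≡ b)
  _≟G_ = F._≟_

  -- coefficient of z in the product  X · Y  in ZG, where X is the
  -- basic set containing x and Y the basic set containing y:
  -- |{(a , b) ∈ X × Y | a ⊕ b = z}|
  structConst : (G → ℕ) → G → G → G → ℕ
  structConst cls x y z =
    sum (map (λ a → sum (map (λ b →
           ⌊ cls a ≟ cls x ⌋ * ⌊ cls b ≟ cls y ⌋ * ⌊ (a ⊕ b) ≟G z ⌋)
         (allFin n))) (allFin n))

  -- S-ring: {e} is a basic set, basic sets closed under inversion, and
  -- the Z-span of the basic sums is closed under multiplication, i.e.
  -- every X · Y has coefficients constant on each basic set.
  record IsSRing (cls : G → ℕ) : Set where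
    field
      identityBlock : ∀ x → cls x ≡ cls e → x ≡ e
      inverseClosed : ∀ x y → cls x ≡ cls y → cls (inv x) ≡ cls (inv y)
      productClosed : ∀ x y z z′ → cls z ≡ cls z′ →
                      structConst cls x y z ≡ structConst cls x y z′

  record IsOverGroup (Γ : Permutation′ n → Set) : Set where
    field
      has-id     : Γ id
      has-comp   : ∀ π σ → Γ π → Γ σ → Γ (π ∘ₚ σ)
      has-inv    : ∀ π → Γ π → Γ (flip π)
      has-transl : ∀ g → Σ (Permutation′ n) λ π →
                     Γ π × (∀ x → π ⟨$⟩ʳ x ≡ x ⊕ g)

  IsSchurian : (G → ℕ) → Set₁
  IsSchurian cls = Σ (Permutation′ n → Set) λ Γ → IsOverGroup Γ ×
    (∀ x y → (cls x ≡ cls y) ⇔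
       (Σ (Permutation′ n) λ π → Γ π × (π ⟨$⟩ʳ e ≡ e) × (π ⟨$⟩ʳ x ≡ y)))

IsSchurGroupℤ : (n : ℕ) .{{_ : NonZero n}} → Set₁
IsSchurGroupℤ n = ∀ (cls : Fin n → ℕ) → IsSRing cls → IsSchurian cls
  where open Cyclic n

{-# OPTIONS --safe #-}
module Submission where

-- Write n₁ = l h b with h ∣ 2 and n₂ = a c, where l h, k = h b, a and c are at least 3 (n₁ and n₂
-- possibly exchanged).  The group has four sections: the subgroups A₁, A₂ of orders l h and a of the
-- two factors, and the quotients B₁, B₂ of orders k and c.  On each of them inversion is nontrivial.
-- Tie together the inversions on A₁ and A₂, on A₂ and B₁, and on B₁ and B₂, but leave those on A₁ and
-- B₂ independent.  The resulting orbits form an S-ring, since two local choices never have to be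
-- compared on one product: A₁ and B₁ overlap in a section of order h, on which inversion is trivial.
-- A permutation which fixes 0, inverts A₁ and fixes a generator of B₂ would, following the three ties,
-- also invert B₂.

open import Defs
open import Data.Bool using (Bool; true; false; if_then_else_)
open import Data.Empty using (⊥)
open import Data.Fin using (Fin; zero; suc; toℕ; fromℕ<)
open import Data.Fin.Permutation using (Permutation′; permutation; _⟨$⟩ʳ_; _∘ₚ_)
open import Data.Fin.Properties using (toℕ-fromℕ<; toℕ-injective; toℕ<n; toℕ≤n)
import Data.Integer as ℤ
open import Data.Integer using (ℤ; +_; 0ℤ; 1ℤ)
open import Data.Integer.DivMod using (_%ℕ_; _/ℕ_; n%ℕd<d; a≡a%ℕn+[a/ℕn]*n)
open import Data.Integer.Divisibility.Signed
open import Data.Integer.Properties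
  using (neg-involutive; ∣i∣≡0⇒i≡0; i-j≡0⇒i≡j; ∣m⊝n∣≤m⊔n; +-injective; m-n≡m⊖n; ⊖-≥; pos-*)
open import Data.Integer.Tactic.RingSolver using (solve)
open import Data.List using (_∷_; []; map; allFin; tabulate)
open import Data.List.Properties using (map-tabulate)
import Data.Nat as ℕ
import Data.Nat.Divisibility as ℕ
import Data.Nat.Properties as ℕ
open import Data.Nat using (ℕ; NonZero)
open import Data.Nat.Coprimality using (Coprime; coprime-Bézout) renaming (sym to Coprime-sym)
open import Data.Nat.GCD using (module Bézout)
open Bézout.Identity using (+-; -+)
open import Data.Nat.ListAction using (sum)
open import Data.Nat.Primality using (prime⇒nonTrivial)
open import Data.Product using (Σ; ∃; _×_; _,_; proj₁; proj₂)
open import Data.Sum using (_⊎_; inj₁; inj₂)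
open import Function using (_∘_; id)
open import Function.Bundles using (_⇔_; mk⇔; Equivalence)
open import Relation.Binary using (Decidable; IsEquivalence)
open import Relation.Binary.PropositionalEquality
open import Relation.Nullary using (¬_; Dec; yes; no; does; contradiction)
open import Relation.Nullary.Decidable
  using (map′; does-⇔; dec-true; dec-false; _×-dec_; _⊎-dec_)

open import Algebra.Properties.CommutativeMonoid.Sum ℕ.+-0-commutativeMonoid
  using (sum-permute; sum-cong-≗) renaming (sum to ∑)

-- Integer congruences, exact and up to sign.

module Congruence where

  open import Data.Integer using (_+_; _*_; _-_; -_)

  ∣-resp : ∀ {m u v} → m ∣ u → u ≡ v → m ∣ v
  ∣-resp p eq = subst (_ ∣_) eq p

  mod-refl : ∀ m x → m ∣ x - x
  mod-refl m x = divides 0ℤ (solve (x ∷ m ∷ []))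

  *-mono-∣ : ∀ {i j m n} → i ∣ j → m ∣ n → i * m ∣ j * n
  *-mono-∣ {i} {j} {m} {n} p q = ∣-trans (*-monoˡ-∣ m p) (*-monoʳ-∣ j q)

  if-elim : ∀ {A : Set} (P : ℤ → Set) (d : Dec A) {u v} →
            (A → P u) → (¬ A → P v) → P (if does d then u else v)
  if-elim P (yes a) f g = f a
  if-elim P (no ¬a) f g = g ¬a

  if-yes : ∀ {A : Set} (d : Dec A) {u v : ℤ} → A → (if does d then u else v) ≡ u
  if-yes (yes _) a = refl
  if-yes (no ¬a) a = contradiction a ¬a

  if-no : ∀ {A : Set} (d : Dec A) {u v : ℤ} → ¬ A → (if does d then u else v) ≡ v
  if-no (yes a) ¬a = contradiction a ¬a
  if-no (no _)  ¬a = refl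

  Sim : ℤ → ℤ → ℤ → Set
  Sim m x y = (m ∣ x - y) ⊎ (m ∣ x + y)

  sim? : ∀ m x y → Dec (Sim m x y)
  sim? m x y = (m ∣? (x - y)) ⊎-dec (m ∣? (x + y))

  Sim-neg : ∀ m x → Sim m x (- x)
  Sim-neg m x = inj₂ (divides 0ℤ (solve (x ∷ m ∷ [])))

  Sim-sym : ∀ {m} x y → Sim m x y → Sim m y x
  Sim-sym x y (inj₁ p) = inj₁ (∣-resp (∣m⇒∣-m p) (solve (x ∷ y ∷ [])))
  Sim-sym x y (inj₂ p) = inj₂ (∣-resp p (solve (x ∷ y ∷ [])))

  Sim-trans : ∀ {m} x y z → Sim m x y → Sim m y z → Sim m x z
  Sim-trans x y z (inj₁ p) (inj₁ q) = inj₁ (∣-resp (∣m∣n⇒∣m+n p q) (solve (x ∷ y ∷ z ∷ [])))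
  Sim-trans x y z (inj₁ p) (inj₂ q) = inj₂ (∣-resp (∣m∣n⇒∣m+n p q) (solve (x ∷ y ∷ z ∷ [])))
  Sim-trans x y z (inj₂ p) (inj₁ q) = inj₂ (∣-resp (∣m∣n⇒∣m-n p q) (solve (x ∷ y ∷ z ∷ [])))
  Sim-trans x y z (inj₂ p) (inj₂ q) = inj₁ (∣-resp (∣m∣n⇒∣m-n p q) (solve (x ∷ y ∷ z ∷ [])))

  Sim∧∤⇒∣+ : ∀ {m} x y → Sim m x y → ¬ m ∣ x - y → m ∣ x + y
  Sim∧∤⇒∣+ x y (inj₁ p) m∤x-y = contradiction p m∤x-y
  Sim∧∤⇒∣+ x y (inj₂ p) _     = p

  Sim-weaken : ∀ {m m′} x y → m ∣ m′ → Sim m′ x y → Sim m x y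
  Sim-weaken x y d (inj₁ p) = inj₁ (∣-trans d p)
  Sim-weaken x y d (inj₂ p) = inj₂ (∣-trans d p)

  Sim⇒∣ : ∀ {m} x y → Sim m x y → m ∣ x → m ∣ y
  Sim⇒∣ x y (inj₁ p) q = ∣-resp (∣m∣n⇒∣m-n q p) (solve (x ∷ y ∷ []))
  Sim⇒∣ x y (inj₂ p) q = ∣-resp (∣m∣n⇒∣m-n p q) (solve (x ∷ y ∷ []))

  Sim⇒does≡ : ∀ {m} x y → Sim m x y → does (m ∣? x) ≡ does (m ∣? y)
  Sim⇒does≡ {m} x y p =
    does-⇔ (mk⇔ (Sim⇒∣ x y p) (Sim⇒∣ y x (Sim-sym x y p))) (m ∣? x) (m ∣? y)

  -- A Bézout identity splits 1 into the Chinese remainder idempotents ε and 1 - ε; the two clauses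
  -- are the two signs that the identity may have over ℕ.
  idempotent : ∀ {m n} → Coprime m n → ∃ λ ε → + n ∣ ε × + m ∣ 1ℤ - ε
  idempotent {m} {n} coprime with coprime-Bézout coprime
  ... | +- x y eq = - + y * + n , divides (- + y) refl , divides (+ x)
        (trans (lemma (+ y) (+ n)) (trans (cong (λ i → 1ℤ + i) (sym (pos-* y n))) (trans (cong +_ eq) (pos-* x m))))
    where
    lemma : ∀ y n → 1ℤ - (- y * n) ≡ 1ℤ + y * n
    lemma y n = solve (y ∷ n ∷ [])
  ... | -+ x y eq = + y * + n , divides (+ y) refl , divides (- + x)
        (trans (cong (λ i → 1ℤ - i) (trans (sym (pos-* y n)) (trans (cong +_ (sym eq)) (cong (λ i → 1ℤ + i) (pos-* x m)))))
          (lemma (+ x) (+ m)))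
    where
    lemma : ∀ x m → 1ℤ - (1ℤ + x * m) ≡ - x * m
    lemma x m = solve (x ∷ m ∷ [])

open Congruence

-- The partition of the integers and the bijections that respect it.

module Blocks
  (N N₁ N₂ b c k ε : ℤ)
  (N≡N₁N₂ : N ≡ N₁ ℤ.* N₂)
  (b∣k : b ∣ k) (k∣N₁ : k ∣ N₁) (k∣2b : k ∣ + 2 ℤ.* b) (c∣N₂ : c ∣ N₂)
  (N₂∣ε : N₂ ∣ ε) (N₁∣1-ε : N₁ ∣ 1ℤ ℤ.- ε)
  where

  open import Data.Integer using (_+_; _*_; _-_; -_)

  -- The arguments tell whether x lies in the subgroups b ℤ and c ℤ.  The signs modulo N₁ and modulo c are
  -- independent in the second case only.
  Close : Bool → Bool → ℤ → ℤ → Set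
  Close true  true  x y = Sim N x y
  Close true  false x y = Sim N₁ x y × Sim c x y
  Close false true  x y = Sim (k * N₂) x y
  Close false false x y = Sim (k * c) x y

  infix 4 _~_ _~?_

  record _~_ (x y : ℤ) : Set where
    constructor sameBlock
    field close : Close (does (b ∣? x)) (does (c ∣? x)) x y
  open _~_

  close? : ∀ p q x y → Dec (Close p q x y)
  close? true  true  x y = sim? N x y
  close? true  false x y = sim? N₁ x y ×-dec sim? c x y
  close? false true  x y = sim? (k * N₂) x y
  close? false false x y = sim? (k * c) x y

  _~?_ : ∀ x y → Dec (x ~ y)
  x ~? y = map′ sameBlock close (close? (does (b ∣? x)) (does (c ∣? x)) x y)

  b∣N₁ : b ∣ N₁
  b∣N₁ = ∣-trans b∣k k∣N₁

  N₁∣N : N₁ ∣ N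
  N₁∣N = ∣-resp (∣m⇒∣m*n N₂ ∣-refl) (sym N≡N₁N₂)

  N₂∣N : N₂ ∣ N
  N₂∣N = ∣-resp (∣n⇒∣m*n N₁ ∣-refl) (sym N≡N₁N₂)

  b∣N : b ∣ N
  b∣N = ∣-trans b∣N₁ N₁∣N

  c∣N : c ∣ N
  c∣N = ∣-trans c∣N₂ N₂∣N

  kN₂∣N : k * N₂ ∣ N
  kN₂∣N = ∣-resp (*-mono-∣ k∣N₁ ∣-refl) (sym N≡N₁N₂)

  kc∣N : k * c ∣ N
  kc∣N = ∣-resp (*-mono-∣ k∣N₁ c∣N₂) (sym N≡N₁N₂)

  Close⇒Sim-b : ∀ p q x y → Close p q x y → Sim b x y
  Close⇒Sim-b true  true  x y = Sim-weaken x y b∣N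
  Close⇒Sim-b true  false x y = Sim-weaken x y b∣N₁ ∘ proj₁
  Close⇒Sim-b false true  x y = Sim-weaken x y (∣m⇒∣m*n N₂ b∣k)
  Close⇒Sim-b false false x y = Sim-weaken x y (∣m⇒∣m*n c b∣k)

  Close⇒Sim-c : ∀ p q x y → Close p q x y → Sim c x y
  Close⇒Sim-c true  true  x y = Sim-weaken x y c∣N
  Close⇒Sim-c true  false x y = proj₂
  Close⇒Sim-c false true  x y = Sim-weaken x y (∣n⇒∣m*n k c∣N₂)
  Close⇒Sim-c false false x y = Sim-weaken x y (∣n⇒∣m*n k ∣-refl)

  Close-sym : ∀ p q x y → Close p q x y → Close p q y x
  Close-sym true  true  x y = Sim-sym x y
  Close-sym true  false x y (r , s) = Sim-sym x y r , Sim-sym x y s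
  Close-sym false true  x y = Sim-sym x y
  Close-sym false false x y = Sim-sym x y

  Close-trans : ∀ p q x y z → Close p q x y → Close p q y z → Close p q x z
  Close-trans true  true  x y z = Sim-trans x y z
  Close-trans true  false x y z (r , s) (r′ , s′) = Sim-trans x y z r r′ , Sim-trans x y z s s′
  Close-trans false true  x y z = Sim-trans x y z
  Close-trans false false x y z = Sim-trans x y z

  Close-neg : ∀ p q x → Close p q x (- x)
  Close-neg true  true  x = Sim-neg N x
  Close-neg true  false x = Sim-neg N₁ x , Sim-neg c x
  Close-neg false true  x = Sim-neg (k * N₂) x
  Close-neg false false x = Sim-neg (k * c) x

  Close-cong : ∀ p q x y → N ∣ x - y → Close p q x y
  Close-cong true  true  x y r = inj₁ r
  Close-cong true  false x y r = inj₁ (∣-trans N₁∣N r) , inj₁ (∣-trans c∣N r)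
  Close-cong false true  x y r = inj₁ (∣-trans kN₂∣N r)
  Close-cong false false x y r = inj₁ (∣-trans kc∣N r)

  -- Every case of `Close` implies congruence up to sign modulo `b`, so membership in b ℤ is
  -- constant on blocks. With the same for `c`, symmetry and transitivity may read the case off any
  -- member.
  ~⇒does-b : ∀ {x y} → x ~ y → does (b ∣? x) ≡ does (b ∣? y)
  ~⇒does-b {x} {y} r = Sim⇒does≡ x y (Close⇒Sim-b _ (does (c ∣? x)) x y (close r))

  ~⇒does-c : ∀ {x y} → x ~ y → does (c ∣? x) ≡ does (c ∣? y)
  ~⇒does-c {x} {y} r = Sim⇒does≡ x y (Close⇒Sim-c (does (b ∣? x)) _ x y (close r))

  ~-sym : ∀ {x y} → x ~ y → y ~ x
  ~-sym {x} {y} r = sameBlock (subst₂ (λ p q → Close p q y x) (~⇒does-b r) (~⇒does-c r)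
    (Close-sym _ _ x y (close r)))

  ~-trans : ∀ {x y z} → x ~ y → y ~ z → x ~ z
  ~-trans {x} {y} {z} r s = sameBlock (Close-trans _ _ x y z (close r)
    (subst₂ (λ p q → Close p q y z) (sym (~⇒does-b r)) (sym (~⇒does-c r)) (close s)))

  ~-neg : ∀ x → x ~ (- x)
  ~-neg x = sameBlock (Close-neg _ _ x)

  ~-cong : ∀ {x y} → N ∣ x - y → x ~ y
  ~-cong {x} {y} p = sameBlock (Close-cong _ _ x y p)

  ~-refl : ∀ x → x ~ x
  ~-refl x = ~-cong (mod-refl N x)

  ~-reflexive : ∀ {x y} → x ≡ y → x ~ y
  ~-reflexive {x} refl = ~-refl x

  ~-resp : ∀ {x y x′ y′} → N ∣ x - x′ → N ∣ y - y′ → x ~ y → x′ ~ y′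
  ~-resp p q r = ~-trans (~-sym (~-cong p)) (~-trans r (~-cong q))

  ~⇔Close : ∀ {x y p q} → does (b ∣? x) ≡ p → does (c ∣? x) ≡ q → x ~ y ⇔ Close p q x y
  ~⇔Close refl refl = mk⇔ close sameBlock

  module _ {x y : ℤ} where

    ~-inner : b ∣ x → c ∣ x → x ~ y ⇔ Sim N x y
    ~-inner p q = ~⇔Close (dec-true (b ∣? x) p) (dec-true (c ∣? x) q)

    ~-left : b ∣ x → ¬ c ∣ x → x ~ y ⇔ (Sim N₁ x y × Sim c x y)
    ~-left p q = ~⇔Close (dec-true (b ∣? x) p) (dec-false (c ∣? x) q)

    ~-right : ¬ b ∣ x → c ∣ x → x ~ y ⇔ Sim (k * N₂) x y
    ~-right p q = ~⇔Close (dec-false (b ∣? x) p) (dec-true (c ∣? x) q)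

    ~-outer : ¬ b ∣ x → ¬ c ∣ x → x ~ y ⇔ Sim (k * c) x y
    ~-outer p q = ~⇔Close (dec-false (b ∣? x) p) (dec-false (c ∣? x) q)

  -- A bijection a ↦ to a which preserves the blocks of a and of z - a as z is replaced by z′ shows that z
  -- and z′ have the same coefficient in every product of basic sets.
  record Move (z z′ : ℤ) : Set where
    field
      to from   : ℤ → ℤ
      from-to   : ∀ x y → N ∣ y - to x → N ∣ from y - x
      to-from   : ∀ x y → N ∣ y - from x → N ∣ to y - x
      keeps     : ∀ a → a ~ to a
      keepsDiff : ∀ a → z - a ~ z′ - to a

  Move-cong : ∀ {z z′} → N ∣ z - z′ → Move z z′
  Move-cong {z} {z′} p = record
    { to = id ; from = id ; from-to = λ _ _ → id ; to-from = λ _ _ → id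
    ; keeps = ~-refl
    ; keepsDiff = λ a → ~-cong {z - a} {z′ - a} (∣-resp p (solve (z ∷ z′ ∷ a ∷ []))) }

  Move-trans : ∀ {z z′ z″} → Move z z′ → Move z′ z″ → Move z z″
  Move-trans {z} {z′} {z″} f g = record
    { to = G.to ∘ F.to ; from = F.from ∘ G.from
    ; from-to = λ x y p → F.from-to x _ (G.from-to _ y p)
    ; to-from = λ x y p → G.to-from x _ (F.to-from _ y p)
    ; keeps = λ a → ~-trans (F.keeps a) (G.keeps (F.to a))
    ; keepsDiff = λ a → ~-trans (F.keepsDiff a) (G.keepsDiff (F.to a)) }
    where module F = Move f
          module G = Move g

  Move-neg : ∀ z → Move z (- z)
  Move-neg z = record
    { to = -_ ; from = -_ ; from-to = inv ; to-from = inv ; keeps = ~-neg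
    ; keepsDiff = λ a → subst (z - a ~_) (eq a) (~-neg (z - a)) }
    where
    inv : ∀ x y → N ∣ y - - x → N ∣ - y - x
    inv x y p = ∣-resp (∣m⇒∣-m p) (solve (x ∷ y ∷ []))
    eq : ∀ a → - (z - a) ≡ - z - - a
    eq a = solve (z ∷ a ∷ [])

  -- If z ≡ - z′, move to - z′ and negate; so only plain congruences need a construction.
  Move-Sim : ∀ {m z} → (∀ {z′} → m ∣ z - z′ → Move z z′) → ∀ {z′} → Sim m z z′ → Move z z′
  Move-Sim f (inj₁ p) = f p
  Move-Sim {m} {z} f {z′} (inj₂ p) =
    Move-trans (f { - z′} (∣-resp p (solve (z ∷ z′ ∷ []))))
      (subst (Move (- z′)) (neg-involutive z′) (Move-neg (- z′)))

  -- In both cases outside b ℤ the modulus of `Close` divides k N₂, so the blocks there are unions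
  -- of cosets of k N₂ ℤ.
  ~-absorb-b : ∀ {x y} → ¬ b ∣ x → k * N₂ ∣ x - y → x ~ y
  ~-absorb-b {x} b∤x p with c ∣? x
  ... | yes c∣x = Equivalence.from (~-right b∤x c∣x) (inj₁ p)
  ... | no  c∤x = Equivalence.from (~-outer b∤x c∤x) (inj₁ (∣-trans (*-mono-∣ (∣-refl {k}) c∣N₂) p))

  ~-absorb-c : ∀ {x y} → ¬ c ∣ x → N₁ * c ∣ x - y → x ~ y
  ~-absorb-c {x} c∤x p with b ∣? x
  ... | yes b∣x = Equivalence.from (~-left b∣x c∤x)
                    (inj₁ (∣-trans (∣m⇒∣m*n c ∣-refl) p) , inj₁ (∣-trans (∣n⇒∣m*n N₁ ∣-refl) p))
  ... | no  b∤x = Equivalence.from (~-outer b∤x c∤x) (inj₁ (∣-trans (*-mono-∣ k∣N₁ (∣-refl {c})) p))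

  -- Moves by translation outside a subgroup.

  module Shift {d m : ℤ} (d∣N : d ∣ N) (d∣m : d ∣ m)
    (absorb : ∀ {x y} → ¬ d ∣ x → m ∣ x - y → x ~ y) where

    shift : ℤ → ℤ → ℤ
    shift t a = if does (d ∣? a) then a else a + t

    -- As `d` divides `m` and hence `t`, the translation preserves d ℤ and its complement, and
    -- translating back undoes it.
    shift-inverse : ∀ t u → m ∣ t → N ∣ t + u → ∀ x y → N ∣ y - shift t x → N ∣ shift u y - x
    shift-inverse t u m∣t N∣t+u x y = if-elim (λ v → N ∣ y - v → N ∣ shift u y - x) (d ∣? x)
      (λ d∣x p → ∣-resp p (cong (_- x) (sym (if-yes (d ∣? y)
        (∣-resp (∣m∣n⇒∣m+n (∣-trans d∣N p) d∣x) (solve (x ∷ y ∷ [])))))))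
      (λ d∤x p → ∣-resp (∣m∣n⇒∣m+n p N∣t+u) (trans arith (cong (_- x) (sym (if-no (d ∣? y)
        (λ d∣y → d∤x (∣-resp (∣m∣n⇒∣m-n (∣m∣n⇒∣m-n d∣y (∣-trans d∣N p)) (∣-trans d∣m m∣t))
          (solve (x ∷ y ∷ t ∷ [])))))))))
      where
      arith : y - (x + t) + (t + u) ≡ y + u - x
      arith = solve (x ∷ y ∷ t ∷ u ∷ [])

    -- Translate by z′ - z outside d ℤ only. If a is translated, the difference z - a does not
    -- change; if a is in d ℤ, then z - a is outside and absorbs the translation.
    Move-shift : ∀ {z z′} → ¬ d ∣ z → m ∣ z - z′ → Move z z′
    Move-shift {z} {z′} d∤z p = record
      { to = shift (z′ - z) ; from = shift (z - z′)
      ; from-to = shift-inverse (z′ - z) (z - z′) m∣t (∣-resp (mod-refl N z) (solve (z ∷ z′ ∷ [])))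
      ; to-from = shift-inverse (z - z′) (z′ - z) p (∣-resp (mod-refl N z) (solve (z ∷ z′ ∷ [])))
      ; keeps = λ a → if-elim (a ~_) (d ∣? a) (λ _ → ~-refl a)
          (λ d∤a → absorb d∤a (∣-resp p (solve (a ∷ z ∷ z′ ∷ []))))
      ; keepsDiff = λ a → if-elim (λ v → z - a ~ z′ - v) (d ∣? a)
          (λ d∣a → absorb (λ q → d∤z (∣-resp (∣m∣n⇒∣m+n q d∣a) (solve (a ∷ z ∷ []))))
             (∣-resp p (solve (a ∷ z ∷ z′ ∷ []))))
          (λ _ → ~-reflexive (solve (a ∷ z ∷ z′ ∷ []))) }
      where
      m∣t : m ∣ z′ - z
      m∣t = ∣-resp (∣m⇒∣-m p) (solve (z ∷ z′ ∷ []))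

  open Shift b∣N (∣m⇒∣m*n N₂ b∣k) ~-absorb-b using () renaming (Move-shift to Move-shift-b)
  open Shift c∣N (∣n⇒∣m*n N₁ (∣-refl {c})) ~-absorb-c using () renaming (Move-shift to Move-shift-c)

  -- ε is 1 modulo N₁ and 0 modulo N₂, so flip changes the sign of the first component only.
  flip : ℤ → ℤ
  flip x = x - + 2 * (ε * x)

  flip-sum : ∀ x → N₁ ∣ x + flip x
  flip-sum x = ∣-resp (∣n⇒∣m*n (+ 2) (∣m⇒∣m*n x N₁∣1-ε)) (flip-sum-eq x)
    where
    flip-sum-eq : ∀ x → + 2 * ((1ℤ - ε) * x) ≡ x + (x - + 2 * (ε * x))
    flip-sum-eq x = solve (x ∷ ε ∷ [])

  c∣ε : c ∣ ε
  c∣ε = ∣-trans c∣N₂ N₂∣ε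

  flip-diff : ∀ x → N₂ ∣ x - flip x
  flip-diff x = ∣-resp (∣n⇒∣m*n (+ 2) (∣m⇒∣m*n x N₂∣ε)) flip-diff-eq
    where
    flip-diff-eq : + 2 * (ε * x) ≡ x - (x - + 2 * (ε * x))
    flip-diff-eq = solve (x ∷ ε ∷ [])

  ~-flip : ∀ {x y} → b ∣ x → ¬ c ∣ x → N₁ ∣ x + y → c ∣ x - y → x ~ y
  ~-flip b∣x c∤x p q = Equivalence.from (~-left b∣x c∤x) (inj₂ p , inj₁ q)

  -- Chinese remainder theorem, from x = x ε + (1 - ε) x: in each summand one factor supplies `N₁`
  -- and the other `N₂`.
  N-combine : ∀ {x} → N₁ ∣ x → N₂ ∣ x → N ∣ x
  N-combine {x} p q = ∣-resp (subst (_∣ x * ε + (1ℤ - ε) * x) (sym N≡N₁N₂) (∣m∣n⇒∣m+n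
      (*-mono-∣ p N₂∣ε) (*-mono-∣ N₁∣1-ε q)))
    (solve (x ∷ ε ∷ []))

  N₁c-combine : ∀ {x} → N₁ ∣ x → c ∣ x → N₁ * c ∣ x
  N₁c-combine {x} p q = ∣-resp (∣m∣n⇒∣m+n (*-mono-∣ p c∣ε) (*-mono-∣ N₁∣1-ε q))
    (solve (x ∷ ε ∷ []))

  -- The move that changes the sign of the first component only.

  module Twist (z : ℤ) (b∣z : b ∣ z) (c∤z : ¬ c ∣ z) where

    -- On c ℤ the second component has to follow the first one; reflecting the coset z + c ℤ in z does the
    -- same for z - a.  Elsewhere the second component is kept.
    twist : ℤ → ℤ
    twist a =
      if does (b ∣? a)
      then (if does (c ∣? a)
            then - a
            else (if does (c ∣? (a - z)) then flip z + z - a else flip a))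
      else a

    twist-inner : ∀ {a} → b ∣ a → c ∣ a → twist a ≡ - a
    twist-inner p q = trans (if-yes (b ∣? _) p) (if-yes (c ∣? _) q)

    twist-near : ∀ {a} → b ∣ a → ¬ c ∣ a → c ∣ a - z → twist a ≡ flip z + z - a
    twist-near p q r = trans (if-yes (b ∣? _) p) (trans (if-no (c ∣? _) q) (if-yes (c ∣? _) r))

    twist-far : ∀ {a} → b ∣ a → ¬ c ∣ a → ¬ c ∣ a - z → twist a ≡ flip a
    twist-far p q r = trans (if-yes (b ∣? _) p) (trans (if-no (c ∣? _) q) (if-no (c ∣? _) r))

    twist-outer : ∀ {a} → ¬ b ∣ a → twist a ≡ a
    twist-outer p = if-no (b ∣? _) p

    twist-elim : ∀ (P : ℤ → Set) a →
      (b ∣ a → c ∣ a → P (- a)) →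
      (b ∣ a → ¬ c ∣ a → c ∣ a - z → P (flip z + z - a)) →
      (b ∣ a → ¬ c ∣ a → ¬ c ∣ a - z → P (flip a)) →
      (¬ b ∣ a → P a) → P (twist a)
    twist-elim P a inner near far outer = if-elim P (b ∣? a)
      (λ p → if-elim P (c ∣? a) (inner p) (λ q → if-elim P (c ∣? (a - z)) (near p q) (far p q)))
      outer

    c∣flip-diff : ∀ x → c ∣ x - flip x
    c∣flip-diff x = ∣-trans c∣N₂ (flip-diff x)

    b∣flip : ∀ {x} → b ∣ x → b ∣ flip x
    b∣flip {x} p = ∣m∣n⇒∣m-n p (∣n⇒∣m*n (+ 2) (∣n⇒∣m*n ε p))

    c∣flip⇒c∣ : ∀ {x} → c ∣ flip x → c ∣ x
    c∣flip⇒c∣ {x} p = ∣-resp (∣m∣n⇒∣m+n (c∣flip-diff x) p) (lemma x (flip x))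
      where
      lemma : ∀ x y → x - y + y ≡ x
      lemma x y = solve (x ∷ y ∷ [])

    N∣⇒c∣ : ∀ {x y} → N ∣ y - x → c ∣ y → c ∣ x
    N∣⇒c∣ {x} {y} p q = ∣-resp (∣m∣n⇒∣m-n q (∣-trans c∣N p)) (solve (x ∷ y ∷ []))

    N∣⇒b∣ : ∀ {x y} → N ∣ y - x → b ∣ x → b ∣ y
    N∣⇒b∣ {x} {y} p q = ∣-resp (∣m∣n⇒∣m+n (∣-trans b∣N p) q) (solve (x ∷ y ∷ []))

    flip-flip : ∀ x → N ∣ flip (flip x) - x
    flip-flip x = N-combine
      (∣-resp (∣m∣n⇒∣m-n (flip-sum (flip x)) (flip-sum x)) (lemma₁ x (flip x) _))
      (∣-resp (∣m⇒∣-m (∣m∣n⇒∣m+n (flip-diff (flip x)) (flip-diff x))) (lemma₂ x (flip x) _))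
      where
      lemma₁ : ∀ x y w → y + w - (x + y) ≡ w - x
      lemma₁ x y w = solve (x ∷ y ∷ w ∷ [])
      lemma₂ : ∀ x y w → - (y - w + (x - y)) ≡ w - x
      lemma₂ x y w = solve (x ∷ y ∷ w ∷ [])

    flip-cong : ∀ {x y} → N ∣ y - x → N ∣ flip y - flip x
    flip-cong {x} {y} p = ∣-resp (∣n⇒∣m*n (1ℤ - + 2 * ε) p) lemma
      where
      lemma : (1ℤ - + 2 * ε) * (y - x) ≡ (y - + 2 * (ε * y)) - (x - + 2 * (ε * x))
      lemma = solve (x ∷ y ∷ ε ∷ [])

    -- Each of the four regions told apart by `twist` is mapped into itself, so the same branch
    -- applies again, and every branch is an involution modulo `N`.
    twist-involutive : ∀ x y → N ∣ y - twist x → N ∣ twist y - x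
    twist-involutive x y = twist-elim (λ v → N ∣ y - v → N ∣ twist y - x) x
      (λ b∣x c∣x p → via (twist-inner (N∣⇒b∣ p (∣m⇒∣-m b∣x))
                                      (∣-resp (∣m∣n⇒∣m-n (∣-trans c∣N p) c∣x) (solve (x ∷ y ∷ []))))
        (∣-resp (∣m⇒∣-m p) (solve (x ∷ y ∷ []))))
      (λ b∣x c∤x c∣x-z p →
        let c∣y-z : c ∣ y - z
            c∣y-z = ∣-resp (∣m∣n⇒∣m-n (∣m∣n⇒∣m-n (∣-trans c∣N p) c∣x-z) (c∣flip-diff z))
                      (lemma₁ (flip z))
        in via (twist-near (N∣⇒b∣ p (∣m∣n⇒∣m-n (∣m∣n⇒∣m+n (b∣flip b∣z) b∣z) b∣x))
                 (λ c∣y → c∤z (∣-resp (∣m∣n⇒∣m-n c∣y c∣y-z) (solve (y ∷ z ∷ [])))) c∣y-z)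
             (∣-resp (∣m⇒∣-m p) (lemma₂ (flip z))))
      (λ b∣x c∤x c∤x-z p →
        let c∤y : ¬ c ∣ y
            c∤y c∣y = c∤x (c∣flip⇒c∣ (N∣⇒c∣ p c∣y))
            c∤y-z : ¬ c ∣ y - z
            c∤y-z c∣y-z = c∤x-z (∣-resp
              (∣m∣n⇒∣m-n (∣m∣n⇒∣m+n c∣y-z (c∣flip-diff x)) (∣-trans c∣N p)) (lemma₃ (flip x)))
        in via (twist-far (N∣⇒b∣ p (b∣flip b∣x)) c∤y c∤y-z)
             (∣-resp (∣m∣n⇒∣m+n (flip-cong {flip x} {y} p) (flip-flip x)) (lemma₄ (flip y) (flip (flip x)))))
      (λ b∤x p → via (twist-outer (λ b∣y → b∤x
           (∣-resp (∣m∣n⇒∣m-n b∣y (∣-trans b∣N p)) (solve (x ∷ y ∷ []))))) p)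
      where
      via : ∀ {v} → twist y ≡ v → N ∣ v - x → N ∣ twist y - x
      via eq = subst (λ v → N ∣ v - x) (sym eq)
      lemma₁ : ∀ w → y - (w + z - x) - (x - z) - (z - w) ≡ y - z
      lemma₁ w = solve (x ∷ y ∷ z ∷ w ∷ [])
      lemma₂ : ∀ w → - (y - (w + z - x)) ≡ w + z - y - x
      lemma₂ w = solve (x ∷ y ∷ z ∷ w ∷ [])
      lemma₃ : ∀ w → y - z + (x - w) - (y - w) ≡ x - z
      lemma₃ w = solve (x ∷ y ∷ z ∷ w ∷ [])
      lemma₄ : ∀ v w → v - w + (w - x) ≡ v - x
      lemma₄ v w = solve (x ∷ v ∷ w ∷ [])

    -- Here k ∣ 2 b enters: z is in b ℤ, so z ≡ - z modulo `k`, and blocks outside b ℤ do not notice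
    -- the step from `z` to `flip z`.
    flip-kN₂ : k * N₂ ∣ z - flip z
    flip-kN₂ = ∣-resp (*-mono-∣ k∣2z N₂∣ε) lemma
      where
      k∣2z : k ∣ + 2 * z
      k∣2z = ∣-trans k∣2b (*-monoʳ-∣ (+ 2) b∣z)
      lemma : + 2 * z * ε ≡ z - (z - + 2 * (ε * z))
      lemma = solve (z ∷ ε ∷ [])

    twist-keeps : ∀ a → a ~ twist a
    twist-keeps a = twist-elim (a ~_) a
      (λ _ _ → ~-neg a)
      -- Modulo `N₁` the reflection is a ↦ - a, because flip z ≡ - z; modulo `c` it fixes a, because
      -- a ≡ z.
      (λ b∣a c∤a c∣a-z → ~-flip b∣a c∤a
        (∣-resp (flip-sum z) (lemma₁ (flip z)))
        (∣-resp (∣m∣n⇒∣m+n (∣n⇒∣m*n (+ 2) c∣a-z) (c∣flip-diff z)) (lemma₂ (flip z))))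
      (λ b∣a c∤a _ → ~-flip b∣a c∤a (flip-sum a) (c∣flip-diff a))
      (λ _ → ~-refl a)
      where
      lemma₁ : ∀ w → z + w ≡ a + (w + z - a)
      lemma₁ w = solve (a ∷ z ∷ w ∷ [])
      lemma₂ : ∀ w → + 2 * (a - z) + (z - w) ≡ a - (w + z - a)
      lemma₂ w = solve (a ∷ z ∷ w ∷ [])

    twist-keepsDiff : ∀ a → z - a ~ flip z - twist a
    twist-keepsDiff a = twist-elim (λ v → z - a ~ flip z - v) a
      -- Both z and a are negated modulo `N₁`, while a vanishes modulo `c`; so z - a changes its
      -- first sign only.
      (λ b∣a c∣a → ~-flip (∣m∣n⇒∣m-n b∣z b∣a)
        (λ q → c∤z (∣-resp (∣m∣n⇒∣m+n q c∣a) (lemma₁ z)))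
        (∣-resp (flip-sum z) (lemma₂ (flip z)))
        (∣-resp (∣m∣n⇒∣m-n (c∣flip-diff z) (∣n⇒∣m*n (+ 2) c∣a)) (lemma₃ (flip z))))
      -- The reflection is chosen to make the new difference exactly - (z - a).
      (λ _ _ _ → subst (z - a ~_) (lemma₄ (flip z)) (~-neg (z - a)))
      (λ b∣a c∤a c∤a-z → ~-flip (∣m∣n⇒∣m-n b∣z b∣a)
        (λ q → c∤a-z (∣-resp (∣m⇒∣-m q) (solve (z ∷ a ∷ []))))
        (∣-resp (∣m∣n⇒∣m-n (flip-sum z) (flip-sum a)) (lemma₅ (flip z) (flip a)))
        (∣-resp (∣m∣n⇒∣m-n (c∣flip-diff z) (c∣flip-diff a)) (lemma₆ (flip z) (flip a))))
      -- Here a is fixed, and z - a lies outside b ℤ like a.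
      (λ b∤a → ~-absorb-b
        (λ q → b∤a (∣-resp (∣m∣n⇒∣m-n b∣z q) (solve (z ∷ a ∷ []))))
        (∣-resp flip-kN₂ (lemma₇ (flip z))))
      where
      lemma₁ : ∀ z → z - a + a ≡ z
      lemma₁ z = solve (a ∷ z ∷ [])
      lemma₂ : ∀ w → z + w ≡ (z - a) + (w - - a)
      lemma₂ w = solve (a ∷ z ∷ w ∷ [])
      lemma₃ : ∀ w → z - w - + 2 * a ≡ (z - a) - (w - - a)
      lemma₃ w = solve (a ∷ z ∷ w ∷ [])
      lemma₄ : ∀ w → - (z - a) ≡ w - (w + z - a)
      lemma₄ w = solve (a ∷ z ∷ w ∷ [])
      lemma₅ : ∀ w v → z + w - (a + v) ≡ (z - a) + (w - v)
      lemma₅ w v = solve (a ∷ z ∷ w ∷ v ∷ [])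
      lemma₆ : ∀ w v → z - w - (a - v) ≡ (z - a) - (w - v)
      lemma₆ w v = solve (a ∷ z ∷ w ∷ v ∷ [])
      lemma₇ : ∀ w → z - w ≡ (z - a) - (w - a)
      lemma₇ w = solve (a ∷ z ∷ w ∷ [])

    Move-flip : Move z (flip z)
    Move-flip = record
      { to = twist ; from = twist ; from-to = twist-involutive ; to-from = twist-involutive
      ; keeps = twist-keeps ; keepsDiff = twist-keepsDiff }

  -- `flip` yields one point with the required signs. It lies outside c ℤ, so a translation by a
  -- multiple of N₁ c leads from it to any other.
  Move-left : ∀ {z} → b ∣ z → ¬ c ∣ z → ∀ {z′} → N₁ ∣ z + z′ → c ∣ z - z′ → Move z z′
  Move-left {z} b∣z c∤z {z′} p q = Move-trans (Twist.Move-flip z b∣z c∤z)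
    (Move-shift-c (λ r → c∤z (Twist.c∣flip⇒c∣ z b∣z c∤z r))
      (N₁c-combine (∣-resp (∣m∣n⇒∣m-n (flip-sum z) p) (lemma₁ (flip z)))
        (∣-resp (∣m∣n⇒∣m-n q (∣-trans c∣N₂ (flip-diff z))) (lemma₂ (flip z)))))
    where
    lemma₁ : ∀ w → z + w - (z + z′) ≡ w - z′
    lemma₁ w = solve (z ∷ z′ ∷ w ∷ [])
    lemma₂ : ∀ w → z - z′ - (z - w) ≡ w - z′
    lemma₂ w = solve (z ∷ z′ ∷ w ∷ [])

  -- The intermediate point has the first component of z′ and the second of z, so each shift alters
  -- a single component.
  Move-outer : ∀ {z z′} → ¬ b ∣ z → ¬ c ∣ z → k * c ∣ z - z′ → Move z z′
  Move-outer {z} {z′} b∤z c∤z p = Move-trans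
    (Move-shift-b {z} {z - ε * (z - z′)} b∤z
      (∣-resp (*-mono-∣ (∣-trans (∣m⇒∣m*n c (∣-refl {k})) p) N₂∣ε) (solve (z ∷ z′ ∷ ε ∷ []))))
    (Move-shift-c {z - ε * (z - z′)} {z′}
      (λ q → c∤z (∣-resp (∣m∣n⇒∣m+n q (∣m⇒∣m*n (z - z′) c∣ε)) (solve (z ∷ z′ ∷ ε ∷ []))))
      (∣-resp (*-mono-∣ N₁∣1-ε (∣-trans (∣n⇒∣m*n k ∣-refl) p)) (solve (z ∷ z′ ∷ ε ∷ []))))

  ~⇒Move : ∀ {z z′} → z ~ z′ → Move z z′
  ~⇒Move {z} {z′} r with b ∣? z | c ∣? z
  ... | yes p | yes q = Move-Sim Move-cong (Equivalence.to (~-inner p q) r)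
  ... | no p  | yes q = Move-Sim (Move-shift-b p) (Equivalence.to (~-right p q) r)
  ... | no p  | no q  = Move-Sim (Move-outer p q) (Equivalence.to (~-outer p q) r)
  ... | yes p | no q with Equivalence.to (~-left p q) r
  ...   | inj₁ s , inj₁ t = Move-shift-c q (N₁c-combine s t)
  ...   | inj₂ s , inj₁ t = Move-left p q s t
  ...   | inj₂ s , inj₂ t = Move-Sim (Move-shift-c q) (inj₂ (N₁c-combine s t))
  -- Changing the second sign alone amounts to changing the first alone and then negating.
  ...   | inj₁ s , inj₂ t = subst (Move z) (neg-involutive z′) (Move-trans
      (Move-left p q { - z′} s (∣-resp t (solve (z ∷ z′ ∷ []))))
      (Move-neg (- z′)))

-- Numerical labels for the classes of a decidable equivalence.

least : ∀ {n} → (Fin n → Bool) → ℕ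
least {ℕ.zero}  P = 0
least {ℕ.suc n} P = if P zero then 0 else ℕ.suc (least (P ∘ suc))

least-cong : ∀ {n} {P Q : Fin n → Bool} → (∀ i → P i ≡ Q i) → least P ≡ least Q
least-cong {ℕ.zero}  eq = refl
least-cong {ℕ.suc n} eq = cong₂ (λ p m → if p then 0 else ℕ.suc m) (eq zero) (least-cong (eq ∘ suc))

least-attained : ∀ {n} (P : Fin n → Bool) i → P i ≡ true →
                 Σ (Fin n) λ j → toℕ j ≡ least P × P j ≡ true
least-attained {ℕ.suc n} P i Pi with P zero in P0
least-attained {ℕ.suc n} P i       Pi | true  = zero , refl , P0
least-attained {ℕ.suc n} P zero    Pi | false with () ← trans (sym P0) Pi
least-attained {ℕ.suc n} P (suc i) Pi | false =
  let j , eq , Pj = least-attained (P ∘ suc) i Pi in suc j , cong ℕ.suc eq , Pj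

does≡true : ∀ {A : Set} (d : Dec A) → does d ≡ true → A
does≡true (yes a) _ = a

module Labelling {n} {_≈_ : Fin n → Fin n → Set} (≈-equiv : IsEquivalence _≈_) (_≈?_ : Decidable _≈_) where

  private module E = IsEquivalence ≈-equiv

  -- The least member names its class. The default n of `least`, for a predicate that is nowhere
  -- true, does not occur, by reflexivity.
  label : Fin n → ℕ
  label x = least (λ y → does (x ≈? y))

  label⇔ : ∀ x y → label x ≡ label y ⇔ x ≈ y
  label⇔ x y = mk⇔ sound (λ x≈y → least-cong (λ z →
      does-⇔ (mk⇔ (E.trans (E.sym x≈y)) (E.trans x≈y)) (x ≈? z) (y ≈? z)))
    where
    sound : label x ≡ label y → x ≈ y
    sound eq =
      let i , i≡ , x≈i = least-attained _ x (dec-true (x ≈? x) E.refl)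
          j , j≡ , y≈j = least-attained _ y (dec-true (y ≈? y) E.refl)
          i≡j = toℕ-injective (trans i≡ (trans eq (sym j≡)))
      in E.trans (does≡true (x ≈? i) x≈i) (E.sym (subst (y ≈_) (sym i≡j) (does≡true (y ≈? j) y≈j)))

-- Residues modulo n and reindexing of structure constants.

sum-tabulate : ∀ {n} (f : Fin n → ℕ) → sum (tabulate f) ≡ ∑ f
sum-tabulate {ℕ.zero}  f = refl
sum-tabulate {ℕ.suc n} f = cong (f zero ℕ.+_) (sum-tabulate (f ∘ suc))

sum-allFin : ∀ {n} (f : Fin n → ℕ) → sum (map f (allFin n)) ≡ ∑ f
sum-allFin f = trans (cong sum (map-tabulate id f)) (sum-tabulate f)

module Residues (n : ℕ) .{{_ : NonZero n}} where
  open import Data.Integer using (_+_; _*_; _-_; -_; ∣_∣)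
  open Cyclic n

  toℤ : G → ℤ
  toℤ x = + toℕ x

  ι : ℤ → G
  ι x = fromℕ< (n%ℕd<d x n)

  toℤ-ι : ∀ x → + n ∣ toℤ (ι x) - x
  toℤ-ι x = divides (- (x /ℕ n)) (trans
      (cong₂ _-_ (cong +_ (toℕ-fromℕ< (n%ℕd<d x n))) (a≡a%ℕn+[a/ℕn]*n x n))
      (lemma (+ (x %ℕ n)) (x /ℕ n) (+ n)))
    where
    lemma : ∀ r q m → r - (r + q * m) ≡ - q * m
    lemma r q m = solve (r ∷ q ∷ m ∷ [])

  toℤ-ι⁻ : ∀ x → + n ∣ x - toℤ (ι x)
  toℤ-ι⁻ x = ∣-resp (∣m⇒∣-m (toℤ-ι x)) (lemma (toℤ (ι x)))
    where
    lemma : ∀ y → - (y - x) ≡ x - y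
    lemma y = solve (x ∷ y ∷ [])

  toℤ-injective : ∀ {x y} → + n ∣ toℤ x - toℤ y → x ≡ y
  toℤ-injective {x} {y} n∣x-y = toℕ-injective (+-injective (i-j≡0⇒i≡j (toℤ x) (toℤ y) (∣i∣≡0⇒i≡0 (zero? (∣⇒∣ᵤ n∣x-y)))))
    where
    bound : ∣ toℤ x - toℤ y ∣ ℕ.< n
    bound = subst (λ i → ∣ i ∣ ℕ.< n) (sym (m-n≡m⊖n (toℕ x) (toℕ y)))
      (ℕ.≤-<-trans (∣m⊝n∣≤m⊔n (toℕ x) (toℕ y)) (ℕ.⊔-pres-<m (toℕ<n x) (toℕ<n y)))
    zero? : n ℕ.∣ ∣ toℤ x - toℤ y ∣ → ∣ toℤ x - toℤ y ∣ ≡ 0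
    zero? d with ∣ toℤ x - toℤ y ∣ | bound
    ... | ℕ.zero  | _  = refl
    ... | ℕ.suc m | lt = contradiction d (ℕ.>⇒∤ lt)

  ι-cong : ∀ {x y} → + n ∣ x - y → ι x ≡ ι y
  ι-cong {x} {y} p = toℤ-injective (∣-resp (∣m∣n⇒∣m+n (∣m∣n⇒∣m+n (toℤ-ι x) p) (toℤ-ι⁻ y)) (lemma (toℤ (ι x)) (toℤ (ι y))))
    where
    lemma : ∀ a b → a - x + (x - y) + (y - b) ≡ a - b
    lemma a b = solve (a ∷ b ∷ x ∷ y ∷ [])

  ι-toℤ : ∀ x → ι (toℤ x) ≡ x
  ι-toℤ x = toℤ-injective (toℤ-ι (toℤ x))

  toℤ-⊕ : ∀ x y → + n ∣ toℤ (x ⊕ y) - (toℤ x + toℤ y)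
  -- `x ⊕ y` and `ι (toℤ x + toℤ y)` are equal by computation.
  toℤ-⊕ x y = toℤ-ι (toℤ x + toℤ y)

  toℤ-summand : ∀ a b {z} t → a ⊕ b ≡ z → + n ∣ toℤ a - t → + n ∣ toℤ z - t - toℤ b
  toℤ-summand a b t refl p =
    ∣-resp (∣m∣n⇒∣m+n (toℤ-⊕ a b) p) (lemma (toℤ (a ⊕ b)) (toℤ a) (toℤ b))
    where
    lemma : ∀ s a b → s - (a + b) + (a - t) ≡ s - t - b
    lemma s a b = solve (s ∷ a ∷ b ∷ t ∷ [])

  toℤ-inv : ∀ x → + n ∣ toℤ (inv x) - - toℤ x
  toℤ-inv x = ∣-resp (∣m∣n⇒∣m+n (toℤ-ι (+ (n ℕ.∸ toℕ x))) ∣-refl)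
      (trans (cong (λ i → toℤ (inv x) - i + + n) n∸x) (lemma (toℤ (inv x)) (+ n) (toℤ x)))
    where
    n∸x : + (n ℕ.∸ toℕ x) ≡ + n - toℤ x
    n∸x = sym (trans (m-n≡m⊖n n (toℕ x)) (⊖-≥ (toℕ≤n x)))
    lemma : ∀ a m t → a - (m - t) + m ≡ a - - t
    lemma a m t = solve (a ∷ m ∷ t ∷ [])

  toℤ-e : + n ∣ toℤ e
  toℤ-e = ∣-resp (toℤ-ι 0ℤ) (lemma (toℤ e))
    where
    lemma : ∀ x → x - 0ℤ ≡ x
    lemma x = solve (x ∷ [])

  toℤ-diff : ∀ x y → + n ∣ toℤ (x ⊕ inv y) - (toℤ x - toℤ y)
  toℤ-diff x y = ∣-resp (∣m∣n⇒∣m+n (toℤ-⊕ x (inv y)) (toℤ-inv y)) (lemma (toℤ (x ⊕ inv y)) (toℤ x) (toℤ y) (toℤ (inv y)))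
    where
    lemma : ∀ d x y i → d - (x + i) + (i - - y) ≡ d - (x - y)
    lemma d x y i = solve (d ∷ x ∷ y ∷ i ∷ [])

  -- Since y ranges over all representatives of a class, the two inverse laws also say that f and g
  -- respect congruence modulo n.
  lift : (f g : ℤ → ℤ) →
         (∀ x y → + n ∣ y - f x → + n ∣ g y - x) →
         (∀ x y → + n ∣ y - g x → + n ∣ f y - x) → Permutation′ n
  lift f g gf fg = permutation (λ x → ι (f (toℤ x))) (λ x → ι (g (toℤ x)))
    (λ x → trans (ι-cong {f _} {toℤ x} (fg (toℤ x) _ (toℤ-ι (g (toℤ x))))) (ι-toℤ x))
    (λ x → trans (ι-cong {g _} {toℤ x} (gf (toℤ x) _ (toℤ-ι (f (toℤ x))))) (ι-toℤ x))

  translate : ℤ → Permutation′ n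
  translate t = lift (_+ t) (_- t)
    (λ x y p → ∣-resp p (solve (x ∷ y ∷ t ∷ [])))
    (λ x y p → ∣-resp p (solve (x ∷ y ∷ t ∷ [])))

  sumG : (G → ℕ) → ℕ
  sumG f = sum (map f (allFin n))

  sumG-cong : ∀ {f g} → (∀ x → f x ≡ g x) → sumG f ≡ sumG g
  sumG-cong {f} {g} eq = trans (sum-allFin f) (trans (sum-cong-≗ eq) (sym (sum-allFin g)))

  sumG-permute : ∀ f (π : Permutation′ n) → sumG f ≡ sumG (f ∘ (π ⟨$⟩ʳ_))
  sumG-permute f π = trans (sum-allFin f) (trans (sum-permute f π) (sym (sum-allFin (f ∘ (π ⟨$⟩ʳ_)))))

  -- B and B′ are compared under C only: elsewhere both products vanish.
  indicator-product : ∀ {A B C A′ B′ C′ : Set}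
    (a : Dec A) (b : Dec B) (c : Dec C) (a′ : Dec A′) (b′ : Dec B′) (c′ : Dec C′) →
    A ⇔ A′ → C ⇔ C′ → (C → B ⇔ B′) → ⌊ a ⌋ ℕ.* ⌊ b ⌋ ℕ.* ⌊ c ⌋ ≡ ⌊ a′ ⌋ ℕ.* ⌊ b′ ⌋ ℕ.* ⌊ c′ ⌋
  indicator-product a b c a′ b′ c′ A⇔ C⇔ B⇔ with c | c′
  ... | yes p | no ¬p = contradiction (Equivalence.to C⇔ p) ¬p
  ... | no ¬p | yes p = contradiction (Equivalence.from C⇔ p) ¬p
  ... | no _  | no _  = trans (ℕ.*-zeroʳ (⌊ a ⌋ ℕ.* ⌊ b ⌋)) (sym (ℕ.*-zeroʳ (⌊ a′ ⌋ ℕ.* ⌊ b′ ⌋)))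
  ... | yes p | yes _ = cong (ℕ._* 1) (cong₂ ℕ._*_ (⌊⌋-cong a a′ A⇔) (⌊⌋-cong b b′ (B⇔ p)))
    where
    ⌊⌋-cong : ∀ {P Q : Set} (p : Dec P) (q : Dec Q) → P ⇔ Q → ⌊ p ⌋ ≡ ⌊ q ⌋
    ⌊⌋-cong (yes _) (yes _) P⇔Q = refl
    ⌊⌋-cong (yes p) (no ¬q) P⇔Q = contradiction (Equivalence.to P⇔Q p) ¬q
    ⌊⌋-cong (no ¬p) (yes q) P⇔Q = contradiction (Equivalence.from P⇔Q q) ¬p
    ⌊⌋-cong (no _)  (no _)  P⇔Q = refl

  -- Reindex the outer sum by `π` and, for each `a`, the inner sum by the translation that carries
  -- the solution b of a ⊕ b = z to the solution b′ of π a ⊕ b′ = z′.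
  structConst-permute : ∀ (cls : G → ℕ) x y z z′ (π : Permutation′ n) →
    (∀ a → cls (π ⟨$⟩ʳ a) ≡ cls a) →
    (∀ a b b′ → a ⊕ b ≡ z → (π ⟨$⟩ʳ a) ⊕ b′ ≡ z′ → cls b′ ≡ cls b) →
    structConst cls x y z ≡ structConst cls x y z′
  structConst-permute cls x y z z′ π keeps keepsDiff = sym (begin
    sumG (λ a → sumG (λ b → term z′ a b))
      ≡⟨ sumG-permute _ π ⟩
    sumG (λ a → sumG (λ b → term z′ (π ⟨$⟩ʳ a) b))
      ≡⟨ sumG-cong (λ a → trans (sumG-permute _ (translate (δ a))) (sumG-cong (λ b → sym (terms≡ a b)))) ⟩
    sumG (λ a → sumG (λ b → term z a b)) ∎)
    where
    open ≡-Reasoning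
    term : G → G → G → ℕ
    term z a b = ⌊ cls a ℕ.≟ cls x ⌋ ℕ.* ⌊ cls b ℕ.≟ cls y ⌋ ℕ.* ⌊ (a ⊕ b) ≟G z ⌋
    δ : G → ℤ
    δ a = (toℤ z′ - toℤ (π ⟨$⟩ʳ a)) - (toℤ z - toℤ a)
    sum⇔ : ∀ a b → a ⊕ b ≡ z ⇔ (π ⟨$⟩ʳ a) ⊕ (translate (δ a) ⟨$⟩ʳ b) ≡ z′
    sum⇔ a b = mk⇔
      (λ { refl → toℤ-injective (∣-resp
        (∣m∣n⇒∣m-n (∣m∣n⇒∣m+n (toℤ-⊕ (π ⟨$⟩ʳ a) ρb) (toℤ-ι (toℤ b + δ a))) (toℤ-⊕ a b))
        (lemma₁ (toℤ a) (toℤ b) (toℤ (a ⊕ b)) (toℤ (π ⟨$⟩ʳ a)) (toℤ ρb) (toℤ ((π ⟨$⟩ʳ a) ⊕ ρb)) (toℤ z′))) })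
      (λ eq → toℤ-injective (∣-resp
        (∣m∣n⇒∣m-n (∣m∣n⇒∣m-n (toℤ-⊕ a b) (toℤ-⊕ (π ⟨$⟩ʳ a) ρb)) (toℤ-ι (toℤ b + δ a)))
        (trans (lemma₂ (toℤ a) (toℤ b) (toℤ (a ⊕ b)) (toℤ (π ⟨$⟩ʳ a)) (toℤ ρb) (toℤ ((π ⟨$⟩ʳ a) ⊕ ρb)) (toℤ z′) (toℤ z))
          (trans (cong (λ i → toℤ (a ⊕ b) - toℤ z + (toℤ z′ - toℤ i)) eq)
            (lemma₃ (toℤ (a ⊕ b)) (toℤ z) (toℤ z′))))))
      where
      ρb = translate (δ a) ⟨$⟩ʳ b
      lemma₁ : ∀ a b ab πa ρb πρ z′ →
        πρ - (πa + ρb) + (ρb - (b + ((z′ - πa) - (ab - a)))) - (ab - (a + b)) ≡ πρ - z′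
      lemma₁ a b ab πa ρb πρ z′ = solve (a ∷ b ∷ ab ∷ πa ∷ ρb ∷ πρ ∷ z′ ∷ [])
      lemma₂ : ∀ a b ab πa ρb πρ z′ z →
        ab - (a + b) - (πρ - (πa + ρb)) - (ρb - (b + ((z′ - πa) - (z - a)))) ≡ ab - z + (z′ - πρ)
      lemma₂ a b ab πa ρb πρ z′ z = solve (a ∷ b ∷ ab ∷ πa ∷ ρb ∷ πρ ∷ z′ ∷ z ∷ [])
      lemma₃ : ∀ ab z z′ → ab - z + (z′ - z′) ≡ ab - z
      lemma₃ ab z z′ = solve (ab ∷ z ∷ z′ ∷ [])
    terms≡ : ∀ a b → term z a b ≡ term z′ (π ⟨$⟩ʳ a) (translate (δ a) ⟨$⟩ʳ b)
    terms≡ a b = indicator-product (_ ℕ.≟ _) (_ ℕ.≟ _) (_ ≟G _) (_ ℕ.≟ _) (_ ℕ.≟ _) (_ ≟G _)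
      (cls⇔ (sym (keeps a))) (sum⇔ a b)
      (λ eq → cls⇔ (sym (keepsDiff a b _ eq (Equivalence.to (sum⇔ a b) eq))))
      where
      cls⇔ : ∀ {i j k : ℕ} → i ≡ j → i ≡ k ⇔ j ≡ k
      cls⇔ refl = mk⇔ id id

-- The S-ring and its failure to be schurian.

module NonSchurian
  (n : ℕ) .{{_ : NonZero n}} (N₁ N₂ b c k ε : ℤ)
  (n≡N₁N₂ : + n ≡ N₁ ℤ.* N₂)
  (b∣k : b ∣ k) (k∣N₁ : k ∣ N₁) (k∣2b : k ∣ + 2 ℤ.* b) (c∣N₂ : c ∣ N₂)
  (N₂∣ε : N₂ ∣ ε) (N₁∣1-ε : N₁ ∣ 1ℤ ℤ.- ε)
  -- Inversion is nontrivial on A₁ = b ℤ / N₁ ℤ, B₁ = ℤ / k ℤ, A₂ = c ℤ / N₂ ℤ and B₂ = ℤ / c ℤ, in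
  -- this order.
  (N₁∤2b : ¬ N₁ ∣ + 2 ℤ.* b) (k∤2 : ¬ k ∣ + 2) (N₂∤2c : ¬ N₂ ∣ + 2 ℤ.* c) (c∤2 : ¬ c ∣ + 2)
  where

  open import Data.Integer using (_+_; _*_; _-_; -_)
  open Blocks (+ n) N₁ N₂ b c k ε n≡N₁N₂ b∣k k∣N₁ k∣2b c∣N₂ N₂∣ε N₁∣1-ε

  c∤1 : ¬ c ∣ 1ℤ
  c∤1 p = c∤2 (∣n⇒∣m*n (+ 2) p)

  b∤1 : ¬ b ∣ 1ℤ
  b∤1 p = k∤2 (∣-trans k∣2b (*-monoʳ-∣ (+ 2) p))

  -- In components, u = (b , 1), y = (b , c), w = (1 , c), and the fourth point is 1 = (1 , 1): consecutive
  -- points differ by an element of one component, so each tie passes the sign on to the next point.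
  module Contradiction {u y w u′ y′ w′ q′ : ℤ}
    (u₁ : N₁ ∣ u - b) (u₂ : N₂ ∣ u - 1ℤ)
    (y₁ : N₁ ∣ y - b) (y₂ : N₂ ∣ y - c)
    (w₁ : N₁ ∣ w - 1ℤ) (w₂ : N₂ ∣ w - c)
    (u′₁ : N₁ ∣ u + u′) (u′₂ : N₂ ∣ u - u′)
    (y~y′ : y ~ y′) (w~w′ : w ~ w′) (1~q′ : 1ℤ ~ q′)
    (y-u : y - u ~ y′ - u′) (w-y : w - y ~ w′ - y′)
    (q-w : 1ℤ - w ~ q′ - w′) (q-u : 1ℤ - u ~ q′ - u′)
    where

    ∣-sim : ∀ {m} x x′ → m ∣ x → Sim m x x′ → m ∣ x′
    ∣-sim x x′ p s = Sim⇒∣ x x′ s p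

    infixl 6 _⊞_ _⊟_
    _⊞_ : ∀ {m i j} → m ∣ i → m ∣ j → m ∣ i + j
    _⊞_ = ∣m∣n⇒∣m+n
    _⊟_ : ∀ {m i j} → m ∣ i → m ∣ j → m ∣ i - j
    _⊟_ = ∣m∣n⇒∣m-n

    -- The difference y - u vanishes modulo `N₁`, and so does its image; hence y takes over the
    -- changed sign of u.
    N₁∣y+y′ : N₁ ∣ y + y′
    N₁∣y+y′ = ∣-resp (∣-sim (y - u) (y′ - u′) N₁∣y-u
        (proj₁ (Equivalence.to (~-left b∣y-u c∤y-u) y-u)) ⊞ u′₁ ⊞ N₁∣y-u)
        (solve (u ∷ u′ ∷ y ∷ y′ ∷ []))
      where
      N₁∣y-u : N₁ ∣ y - u
      N₁∣y-u = ∣-resp (y₁ ⊟ u₁) (solve (y ∷ u ∷ b ∷ []))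
      b∣y-u : b ∣ y - u
      b∣y-u = ∣-trans b∣N₁ N₁∣y-u
      c∤y-u : ¬ c ∣ y - u
      c∤y-u p = c∤1 (∣-resp (∣-trans c∣N₂ y₂ ⊞ ∣-refl ⊟ ∣-trans c∣N₂ u₂ ⊟ p)
        (solve (y ∷ u ∷ c ∷ [])))

    -- The tie of A₁ and A₂: y is fixed or negated as a whole, and being fixed would give N₁ ∣ 2 b.
    n∣y+y′ : + n ∣ y + y′
    n∣y+y′ = Sim∧∤⇒∣+ y y′ (Equivalence.to (~-inner b∣y c∣y) y~y′) λ p →
      N₁∤2b (∣-resp (N₁∣y+y′ ⊞ ∣-trans N₁∣N p ⊟ ∣n⇒∣m*n (+ 2) y₁) (solve (y ∷ y′ ∷ b ∷ [])))
      where
      b∣y : b ∣ y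
      b∣y = ∣-resp (∣-trans b∣N₁ y₁ ⊞ ∣-refl) (solve (y ∷ b ∷ []))
      c∣y : c ∣ y
      c∣y = ∣-resp (∣-trans c∣N₂ y₂ ⊞ ∣-refl) (solve (y ∷ c ∷ []))

    N₂∣w-y : N₂ ∣ w - y
    N₂∣w-y = ∣-resp (w₂ ⊟ y₂) (solve (w ∷ y ∷ c ∷ []))

    N₂∣w+w′ : N₂ ∣ w + w′
    N₂∣w+w′ = ∣-resp (∣-sim (w - y) (w′ - y′) N₂∣w-y
        (Sim-weaken (w - y) (w′ - y′) (∣n⇒∣m*n k ∣-refl) (Equivalence.to (~-right b∤w-y c∣w-y) w-y))
        ⊞ ∣-trans N₂∣N n∣y+y′ ⊞ N₂∣w-y)
        (solve (y ∷ y′ ∷ w ∷ w′ ∷ []))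
      where
      c∣w-y : c ∣ w - y
      c∣w-y = ∣-trans c∣N₂ N₂∣w-y
      b∤w-y : ¬ b ∣ w - y
      b∤w-y p = b∤1 (∣-resp (p ⊞ ∣-trans b∣N₁ y₁ ⊞ ∣-refl ⊟ ∣-trans b∣N₁ w₁) (solve (w ∷ y ∷ b ∷ [])))

    -- The tie of A₂ and B₁, in the block of w; the plus sign would give N₂ ∣ 2 c.
    k∣w+w′ : k ∣ w + w′
    k∣w+w′ = ∣-trans (∣m⇒∣m*n N₂ ∣-refl)
      (Sim∧∤⇒∣+ w w′ (Equivalence.to (~-right b∤w c∣w) w~w′) λ p →
        N₂∤2c (∣-resp (N₂∣w+w′ ⊞ ∣-trans (∣n⇒∣m*n k ∣-refl) p ⊟ ∣n⇒∣m*n (+ 2) w₂)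
          (solve (w ∷ w′ ∷ c ∷ []))))
      where
      b∤w : ¬ b ∣ w
      b∤w p = b∤1 (∣-resp (p ⊟ ∣-trans b∣N₁ w₁) (solve (w ∷ [])))
      c∣w : c ∣ w
      c∣w = ∣-resp (∣-trans c∣N₂ w₂ ⊞ ∣-refl) (solve (w ∷ c ∷ []))

    N₁∣1-w : N₁ ∣ 1ℤ - w
    N₁∣1-w = ∣-resp (∣m⇒∣-m w₁) (solve (w ∷ []))

    k∣1+q′ : k ∣ 1ℤ + q′
    k∣1+q′ = ∣-resp (∣-trans k∣N₁ (∣-sim (1ℤ - w) (q′ - w′) N₁∣1-w
        (proj₁ (Equivalence.to (~-left (∣-trans b∣N₁ N₁∣1-w) c∤1-w) q-w))) ⊞ k∣w+w′ ⊞ ∣-trans k∣N₁ N₁∣1-w)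
        (solve (w ∷ w′ ∷ q′ ∷ []))
      where
      c∤1-w : ¬ c ∣ 1ℤ - w
      c∤1-w p = c∤1 (∣-resp (p ⊞ ∣-trans c∣N₂ w₂ ⊞ ∣-refl) (solve (w ∷ c ∷ [])))

    -- The tie of B₁ and B₂, in the block of 1; the plus sign would give k ∣ 2.
    c∣1+q′ : c ∣ 1ℤ + q′
    c∣1+q′ = ∣-trans (∣n⇒∣m*n k ∣-refl)
      (Sim∧∤⇒∣+ 1ℤ q′ (Equivalence.to (~-outer b∤1 c∤1) 1~q′) λ p →
        k∤2 (∣-resp (∣-trans (∣m⇒∣m*n c ∣-refl) p ⊞ k∣1+q′) (solve (q′ ∷ []))))

    -- The difference 1 - u vanishes modulo `N₂`, so 1 keeps its sign modulo `c` as u does. It has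
    -- also been negated there, so `c` would divide 2.
    contra : ⊥
    contra = c∤2 (∣-resp (c∣1+q′ ⊟ ∣-trans c∣N₂ N₂∣q′-u′ ⊞ ∣-trans c∣N₂ u′₂ ⊟ ∣-trans c∣N₂ u₂)
        (solve (u ∷ u′ ∷ q′ ∷ [])))
      where
      N₂∣1-u : N₂ ∣ 1ℤ - u
      N₂∣1-u = ∣-resp (∣m⇒∣-m u₂) (solve (u ∷ []))
      b∤1-u : ¬ b ∣ 1ℤ - u
      b∤1-u p = b∤1 (∣-resp (p ⊞ ∣-trans b∣N₁ u₁ ⊞ ∣-refl) (solve (u ∷ b ∷ [])))
      N₂∣q′-u′ : N₂ ∣ q′ - u′
      N₂∣q′-u′ = ∣-sim (1ℤ - u) (q′ - u′) N₂∣1-u (Sim-weaken (1ℤ - u) (q′ - u′) (∣n⇒∣m*n k ∣-refl)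
        (Equivalence.to (~-right b∤1-u (∣-trans c∣N₂ N₂∣1-u)) q-u))

  open Cyclic n
  open Residues n

  infix 4 _≋_ _≋?_

  _≋_ : G → G → Set
  x ≋ y = toℤ x ~ toℤ y

  _≋?_ : ∀ x y → Dec (x ≋ y)
  x ≋? y = toℤ x ~? toℤ y

  ≋-isEquivalence : IsEquivalence _≋_
  ≋-isEquivalence = record { refl = ~-refl _ ; sym = ~-sym ; trans = ~-trans }

  open Labelling ≋-isEquivalence _≋?_

  label⇒~ : ∀ x y → label x ≡ label y → toℤ x ~ toℤ y
  label⇒~ x y = Equivalence.to (label⇔ x y)

  ~⇒label : ∀ x y → toℤ x ~ toℤ y → label x ≡ label y
  ~⇒label x y = Equivalence.from (label⇔ x y)

  0~⇒≡e : ∀ x → toℤ e ~ toℤ x → x ≡ e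
  0~⇒≡e x r = toℤ-injective (∣m∣n⇒∣m-n (Sim⇒∣ (toℤ e) (toℤ x)
    (Equivalence.to (~-inner (∣-trans b∣N toℤ-e) (∣-trans c∣N toℤ-e)) r) toℤ-e) toℤ-e)

  isSRing : IsSRing label
  isSRing = record
    { identityBlock = λ x eq → 0~⇒≡e x (label⇒~ e x (sym eq))
    ; inverseClosed = λ x y eq → ~⇒label (inv x) (inv y)
        (~-trans (~inv x) (~-trans (label⇒~ x y eq) (~-sym (~inv y))))
    ; productClosed = λ x y z z′ eq → product x y z z′ (~⇒Move (label⇒~ z z′ eq)) }
    where
    ~inv : ∀ x → toℤ (inv x) ~ toℤ x
    ~inv x = ~-trans (~-cong (toℤ-inv x)) (~-sym (~-neg (toℤ x)))

    product : ∀ x y z z′ → Move (toℤ z) (toℤ z′) → structConst label x y z ≡ structConst label x y z′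
    product x y z z′ m = structConst-permute label x y z z′ π
      (λ a → ~⇒label (π ⟨$⟩ʳ a) a (~-sym (~-trans (M.keeps (toℤ a)) (~-cong (toℤ-ι⁻ (M.to (toℤ a)))))))
      (λ a b b′ a⊕b≡z πa⊕b′≡z′ → ~⇒label b′ b (~-sym
        (~-resp (toℤ-summand a b (toℤ a) a⊕b≡z (mod-refl (+ n) (toℤ a)))
          (toℤ-summand (π ⟨$⟩ʳ a) b′ (M.to (toℤ a)) πa⊕b′≡z′ (toℤ-ι (M.to (toℤ a)))) (M.keepsDiff (toℤ a)))))
      where
      module M = Move m
      π = lift M.to M.from M.from-to M.to-from

  module _ {Γ : Permutation′ n → Set} (over : IsOverGroup Γ)
    (orbits : ∀ x y → (label x ≡ label y) ⇔
      (Σ (Permutation′ n) λ π → Γ π × (π ⟨$⟩ʳ e ≡ e) × (π ⟨$⟩ʳ x ≡ y))) where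

    open IsOverGroup over

    -- Translate e to y, apply γ, and translate γ y back to e. The composite is in Γ, fixes e and
    -- sends x - y to γ x - γ y.
    preserves-diff : ∀ γ → Γ γ → ∀ x y →
      toℤ x - toℤ y ~ toℤ (γ ⟨$⟩ʳ x) - toℤ (γ ⟨$⟩ʳ y)
    preserves-diff γ Γγ x y =
      let τ , Γτ , τ≡ = has-transl y
          σ , Γσ , σ≡ = has-transl (inv (γ ⟨$⟩ʳ y))
          e⊕y≡y : τ ⟨$⟩ʳ e ≡ y
          e⊕y≡y = trans (τ≡ e) (toℤ-injective (∣-resp (∣m∣n⇒∣m+n (toℤ-⊕ e y) toℤ-e)
            (lemma₁ (toℤ (e ⊕ y)) (toℤ e) (toℤ y))))
          x-y↦x : τ ⟨$⟩ʳ (x ⊕ inv y) ≡ x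
          x-y↦x = trans (τ≡ _) (toℤ-injective (∣-resp (∣m∣n⇒∣m+n (toℤ-⊕ (x ⊕ inv y) y) (toℤ-diff x y))
            (lemma₂ (toℤ ((x ⊕ inv y) ⊕ y)) (toℤ (x ⊕ inv y)) (toℤ x) (toℤ y))))
          π = τ ∘ₚ (γ ∘ₚ σ)
          fixes : π ⟨$⟩ʳ e ≡ e
          fixes = trans (cong (λ i → σ ⟨$⟩ʳ (γ ⟨$⟩ʳ i)) e⊕y≡y) (trans (σ≡ _)
            (toℤ-injective (∣-resp (∣m∣n⇒∣m-n (toℤ-diff (γ ⟨$⟩ʳ y) (γ ⟨$⟩ʳ y)) toℤ-e)
              (lemma₃ (toℤ ((γ ⟨$⟩ʳ y) ⊕ inv (γ ⟨$⟩ʳ y))) (toℤ (γ ⟨$⟩ʳ y)) (toℤ e)))))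
          moves : π ⟨$⟩ʳ (x ⊕ inv y) ≡ (γ ⟨$⟩ʳ x) ⊕ inv (γ ⟨$⟩ʳ y)
          moves = trans (cong (λ i → σ ⟨$⟩ʳ (γ ⟨$⟩ʳ i)) x-y↦x) (σ≡ _)
      in ~-resp (toℤ-diff x y) (toℤ-diff (γ ⟨$⟩ʳ x) (γ ⟨$⟩ʳ y))
           (label⇒~ (x ⊕ inv y) ((γ ⟨$⟩ʳ x) ⊕ inv (γ ⟨$⟩ʳ y)) (Equivalence.from (orbits _ _)
             (π , has-comp τ (γ ∘ₚ σ) Γτ (has-comp γ σ Γγ Γσ) , fixes , moves)))
      where
      lemma₁ : ∀ s e y → s - (e + y) + e ≡ s - y
      lemma₁ s e y = solve (s ∷ e ∷ y ∷ [])
      lemma₂ : ∀ s d x y → s - (d + y) + (d - (x - y)) ≡ s - x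
      lemma₂ s d x y = solve (s ∷ d ∷ x ∷ y ∷ [])
      lemma₃ : ∀ s g e → s - (g - g) - e ≡ s - e
      lemma₃ s g e = solve (s ∷ g ∷ e ∷ [])

    preserves-diffℤ : ∀ γ → Γ γ → ∀ x y → x - y ~ toℤ (γ ⟨$⟩ʳ ι x) - toℤ (γ ⟨$⟩ʳ ι y)
    preserves-diffℤ γ Γγ x y = ~-trans
      (~-cong (∣-resp (∣m∣n⇒∣m-n (toℤ-ι⁻ x) (toℤ-ι⁻ y)) (lemma (toℤ (ι x)) (toℤ (ι y)))))
      (preserves-diff γ Γγ (ι x) (ι y))
      where
      lemma : ∀ x′ y′ → x - x′ - (y - y′) ≡ x - y - (x′ - y′)
      lemma x′ y′ = solve (x ∷ y ∷ x′ ∷ y′ ∷ [])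

    preserves-block : ∀ γ → Γ γ → γ ⟨$⟩ʳ e ≡ e → ∀ x → x ~ toℤ (γ ⟨$⟩ʳ ι x)
    preserves-block γ Γγ γe≡e x = ~-trans (~-cong (toℤ-ι⁻ x))
      (label⇒~ (ι x) (γ ⟨$⟩ʳ ι x) (Equivalence.from (orbits _ _) (γ , Γγ , γe≡e , refl)))

    not-orbits : ⊥
    not-orbits =
      -- The point u = (b , 1) is in b ℤ but not in c ℤ, where the two signs are independent; so
      -- some γ fixing e changes its first sign only.
      let γ , Γγ , γe≡e , γu≡ = Equivalence.to (orbits (ι u) (ι (flip u)))
            (~⇒label (ι u) (ι (flip u)) (~-resp (toℤ-ι⁻ u) (toℤ-ι⁻ (flip u)) u~flip))
          g = λ x → toℤ (γ ⟨$⟩ʳ ι x)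
          gu : + n ∣ g u - flip u
          gu = subst (λ i → + n ∣ toℤ i - flip u) (sym γu≡) (toℤ-ι (flip u))
      in Contradiction.contra {u} {y} {w} {g u} {g y} {g w} {g 1ℤ}
           (mod₁ b 1ℤ) (mod₂ b 1ℤ) (mod₁ b c) (mod₂ b c) (mod₁ 1ℤ c) (mod₂ 1ℤ c)
           (∣-resp (∣m∣n⇒∣m+n (flip-sum u) (∣-trans N₁∣N gu)) (lemma₁ u (flip u) (g u)))
           (∣-resp (∣m∣n⇒∣m-n (flip-diff u) (∣-trans N₂∣N gu)) (lemma₂ u (flip u) (g u)))
           (preserves-block γ Γγ γe≡e y) (preserves-block γ Γγ γe≡e w) (preserves-block γ Γγ γe≡e 1ℤ)
           (preserves-diffℤ γ Γγ y u) (preserves-diffℤ γ Γγ w y)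
           (preserves-diffℤ γ Γγ 1ℤ w) (preserves-diffℤ γ Γγ 1ℤ u)
      where
      -- The Chinese remainder solution with components p and q.
      point : ℤ → ℤ → ℤ
      point p q = p * ε + q * (1ℤ - ε)
      mod₁ : ∀ p q → N₁ ∣ point p q - p
      mod₁ p q = ∣-resp (∣n⇒∣m*n (q - p) N₁∣1-ε) lemma
        where
        lemma : (q - p) * (1ℤ - ε) ≡ p * ε + q * (1ℤ - ε) - p
        lemma = solve (p ∷ q ∷ ε ∷ [])
      mod₂ : ∀ p q → N₂ ∣ point p q - q
      mod₂ p q = ∣-resp (∣n⇒∣m*n (p - q) N₂∣ε) lemma
        where
        lemma : (p - q) * ε ≡ p * ε + q * (1ℤ - ε) - q
        lemma = solve (p ∷ q ∷ ε ∷ [])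
      u y w : ℤ
      u = point b 1ℤ
      y = point b c
      w = point 1ℤ c
      b∣u : b ∣ u
      b∣u = ∣-resp (∣m∣n⇒∣m+n (∣-trans b∣N₁ (mod₁ b 1ℤ)) ∣-refl) (lemma u)
        where
        lemma : ∀ u → u - b + b ≡ u
        lemma u = solve (u ∷ b ∷ [])
      c∤u : ¬ c ∣ u
      c∤u p = c∤1 (∣-resp (∣m∣n⇒∣m-n p (∣-trans c∣N₂ (mod₂ b 1ℤ))) (lemma u))
        where
        lemma : ∀ u → u - (u - 1ℤ) ≡ 1ℤ
        lemma u = solve (u ∷ [])
      u~flip : u ~ flip u
      u~flip = ~-flip b∣u c∤u (flip-sum u) (∣-trans c∣N₂ (flip-diff u))
      lemma₁ : ∀ u f g → u + f + (g - f) ≡ u + g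
      lemma₁ u f g = solve (u ∷ f ∷ g ∷ [])
      lemma₂ : ∀ u f g → u - f - (g - f) ≡ u - g
      lemma₂ u f g = solve (u ∷ f ∷ g ∷ [])

  notSchur : ¬ IsSchurGroupℤ n
  notSchur schur = let _ , over , orbits = schur label isSRing in not-orbits over orbits

-- Factorizations obtained from Ω*.

open import Data.Nat using (_*_; _≤_; s≤s; z≤n)
open import Data.Nat.Properties using (m*n≢0)

3≤⇒∤2 : ∀ {m} → 3 ≤ m → ¬ + m ∣ + 2
3≤⇒∤2 3≤m m∣2 = ℕ.<⇒≱ 3≤m (ℕ.∣⇒≤ (∣⇒∣ᵤ m∣2))

3≤⇒*∤2* : ∀ {m d} .{{_ : NonZero d}} → 3 ≤ m → ¬ + (m * d) ∣ + 2 ℤ.* + d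
3≤⇒*∤2* {m} {d@(ℕ.suc _)} 3≤m p =
  3≤⇒∤2 3≤m (*-cancelʳ-∣ (+ d) (subst (_∣ + 2 ℤ.* + d) (pos-* m d) p))

-- The orders of A₁, B₁, A₂ and B₂ are l h, h b, a and c; h ∣ 2 turns into k ∣ 2 b.
notSchur-product : ∀ l h b a c n .{{_ : NonZero n}} → Coprime (l * h * b) (a * c) →
  n ≡ l * h * b * (a * c) → h ℕ.∣ 2 → 3 ≤ l * h → 3 ≤ h * b → 3 ≤ a → 3 ≤ c → ¬ IsSchurGroupℤ n
-- `3≤⇒*∤2*` cancels b and c, which therefore have to be nonzero.
notSchur-product l h b@ℕ.zero a c n cop eq h∣2 3≤lh 3≤hb 3≤a 3≤c =
  contradiction (subst (3 ≤_) (ℕ.*-zeroʳ h) 3≤hb) λ ()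
notSchur-product l h b@(ℕ.suc _) a c@(ℕ.suc _) n cop eq h∣2 3≤lh 3≤hb 3≤a 3≤c =
  let ε , N₂∣ε , N₁∣1-ε = idempotent cop in
  NonSchurian.notSchur n (+ (l * h * b)) (+ (a * c)) (+ b) (+ c) (+ (h * b)) ε
    (trans (cong +_ eq) (pos-* (l * h * b) (a * c)))
    (∣ᵤ⇒∣ (ℕ.n∣m*n h))
    (∣ᵤ⇒∣ (ℕ.divides l (ℕ.*-assoc l h b)))
    (subst (+ (h * b) ∣_) (pos-* 2 b) (∣ᵤ⇒∣ (ℕ.*-monoˡ-∣ b h∣2)))
    (∣ᵤ⇒∣ (ℕ.n∣m*n a))
    N₂∣ε N₁∣1-ε
    (3≤⇒*∤2* 3≤lh) (3≤⇒∤2 3≤hb) (3≤⇒*∤2* 3≤a) (3≤⇒∤2 3≤c)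

HasΩ⇒1≤ : ∀ {m k} → HasΩ m k → 1 ≤ m
HasΩ⇒1≤ Ω-one = s≤s z≤n
HasΩ⇒1≤ (Ω-step {p} p-prime Ωm) =
  ℕ.*-mono-≤ (ℕ.<⇒≤ (ℕ.nonTrivial⇒n>1 p {{prime⇒nonTrivial p-prime}})) (HasΩ⇒1≤ Ωm)

HasΩ-suc⇒2≤ : ∀ {m k} → HasΩ m (ℕ.suc k) → 2 ≤ m
HasΩ-suc⇒2≤ (Ω-step {p} p-prime Ωm) =
  ℕ.*-mono-≤ (ℕ.nonTrivial⇒n>1 p {{prime⇒nonTrivial p-prime}}) (HasΩ⇒1≤ Ωm)

HasΩ⇒factors : ∀ {m k} → HasΩ m k → 2 ≤ k → ∃ λ a → ∃ λ b → m ≡ a * b × 2 ≤ a × 2 ≤ b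
HasΩ⇒factors (Ω-step {p} p-prime Ωm) (s≤s (s≤s _)) =
  p , _ , refl , ℕ.nonTrivial⇒n>1 p {{prime⇒nonTrivial p-prime}} , HasΩ-suc⇒2≤ Ωm

2≤∧2∤⇒3≤ : ∀ {a m} → ¬ 2 ℕ.∣ m → a ℕ.∣ m → 2 ≤ a → 3 ≤ a
2≤∧2∤⇒3≤ 2∤m a∣m 2≤a = ℕ.≤∧≢⇒< 2≤a λ { refl → 2∤m a∣m }

-- The shapes l h b with h = 1 and h = 2. In the second, the factor 2 counts for A₁ and for B₁, so a
-- and b need only be at least 2.
data Factored (n : ℕ) : Set where
  odd  : ∀ a b → n ≡ a * b → 3 ≤ a → 3 ≤ b → Factored n
  even : ∀ a b → n ≡ a * 2 * b → 2 ≤ a → 2 ≤ b → Factored n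

HasΩ*⇒Factored : ∀ {n k} → HasΩ* n k → 2 ≤ k → Factored n
HasΩ*⇒Factored (Ω*-odd 2∤n Ωn) 2≤k with a , b , refl , 2≤a , 2≤b ← HasΩ⇒factors Ωn 2≤k =
  odd a b refl (2≤∧2∤⇒3≤ 2∤n (ℕ.m∣m*n b) 2≤a) (2≤∧2∤⇒3≤ 2∤n (ℕ.n∣m*n a) 2≤b)
HasΩ*⇒Factored (Ω*-even Ωm) 2≤k with a , b , refl , 2≤a , 2≤b ← HasΩ⇒factors Ωm 2≤k =
  even a b (trans (sym (ℕ.*-assoc 2 a b)) (cong (_* b) (ℕ.*-comm 2 a))) 2≤a 2≤b

3≤*2 : ∀ {a} → 2 ≤ a → 3 ≤ a * 2
3≤*2 2≤a = ℕ.≤-trans (ℕ.n≤1+n 3) (ℕ.*-monoˡ-≤ 2 2≤a)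

3≤2* : ∀ {b} → 2 ≤ b → 3 ≤ 2 * b
3≤2* 2≤b = ℕ.≤-trans (ℕ.n≤1+n 3) (ℕ.*-monoʳ-≤ 2 2≤b)

2∣a*2*b : ∀ a b → 2 ℕ.∣ a * 2 * b
2∣a*2*b a b = ℕ.∣-trans (ℕ.n∣m*n a) (ℕ.m∣m*n b)

notSchur-Factored : ∀ {n₁ n₂} n .{{_ : NonZero n}} → Coprime n₁ n₂ → n ≡ n₁ * n₂ →
  Factored n₁ → Factored n₂ → ¬ IsSchurGroupℤ n
notSchur-Factored n cop eq (odd a b refl 3≤a 3≤b) (odd a′ c refl 3≤a′ 3≤c) =
  notSchur-product a 1 b a′ c n
    (subst (λ m → Coprime (m * b) (a′ * c)) (sym (ℕ.*-identityʳ a)) cop)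
    (trans eq (cong (λ m → m * b * (a′ * c)) (sym (ℕ.*-identityʳ a))))
    (ℕ.1∣ 2) (subst (3 ≤_) (sym (ℕ.*-identityʳ a)) 3≤a) (subst (3 ≤_) (sym (ℕ.*-identityˡ b)) 3≤b)
    3≤a′ 3≤c
notSchur-Factored n cop eq (even a b refl 2≤a 2≤b) (odd a′ c refl 3≤a′ 3≤c) =
  notSchur-product a 2 b a′ c n cop eq ℕ.∣-refl (3≤*2 2≤a) (3≤2* 2≤b) 3≤a′ 3≤c
-- Only the first factor of `notSchur-product` admits an overlap of order 2, so the two factors are
-- exchanged.
notSchur-Factored n cop eq (odd a′ c refl 3≤a′ 3≤c) (even a b refl 2≤a 2≤b) =
  notSchur-product a 2 b a′ c n (Coprime-sym cop) (trans eq (ℕ.*-comm (a′ * c) (a * 2 * b)))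
    ℕ.∣-refl (3≤*2 2≤a) (3≤2* 2≤b) 3≤a′ 3≤c
notSchur-Factored n cop eq (even a b refl _ _) (even a′ b′ refl _ _) =
  contradiction (cop (2∣a*2*b a b , 2∣a*2*b a′ b′)) λ ()

theorem2p1 : (n₁ n₂ : ℕ) .{{_ : NonZero n₁}} .{{_ : NonZero n₂}} →
    Coprime n₁ n₂ →
    Σ ℕ (λ k → HasΩ* n₁ k × 2 ≤ k) →
    Σ ℕ (λ k → HasΩ* n₂ k × 2 ≤ k) →
    ¬ IsSchurGroupℤ (n₁ * n₂) {{m*n≢0 n₁ n₂}}
theorem2p1 n₁ n₂ coprime (_ , Ω*₁ , 2≤k₁) (_ , Ω*₂ , 2≤k₂) =
  notSchur-Factored (n₁ * n₂) {{m*n≢0 n₁ n₂}} coprime refl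
    (HasΩ*⇒Factored Ω*₁ 2≤k₁) (HasΩ*⇒Factored Ω*₂ 2≤k₂)
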